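{- Let $\Lambda$ be a set of positive integers with $1\in\Lambda$, let $p,q$ be nonnegative integers, let $G$ be a finite simple graph, let $(S,\varphi)$ be an external $\Lambda$-selector of width $p$ in $G$, and put $U=V(G)\setminus S$. For every vertex $s\in S$ that is nonisolated in $G$, choose an anchor $a_s\in N_G(s)$. Let $H$ be the simple graph obtained from $G$ by contracting every edge $sa_s$ ($s\in S$ nonisolated) and deleting the isolated vertices of $G$ that belong to $S$. If $H$ is $q$-colorable, then $G$ has a proper coloring with at most $p+q$ colors such that every nonisolated vertex $v$ of $G$ has a color whose multiplicity in its open neighborhood (the number of vertices of $N_G(v)$ with that color) belongs to $\Lambda$.
   Context: All graphs are finite and simple; after contractions, loops and parallel edges are discarded. $N_G(v)$ and $N_G[v]$ denote the open and closed neighborhoods of $v$, and $[p]=\{1,\ldots,p\}$. For a set $\Lambda$ of positive integers with $1\in\Lambda$, an external $\Lambda$-selector of width $p$ in $G$ is a pair $(S,\varphi)$ consisting of an independent set $S\subseteq V(G)$ and a map $\varphi:S\to[p]$ such that for every $x\in V(G)\setminus S$ there is a color $i\in[p]$ with $|N_G[x]\cap\varphi^{ -1}(i)|\in\Lambda$. A graph is $q$-colorable if it has a proper vertex coloring with at most $q$ colors. -}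

module Defs where

open import Level using (Level; 0ℓ)
open import Data.Nat.Base using (ℕ)
open import Data.Fin.Base using (Fin)
open import Data.Fin.Properties using (_≟_)
open import Data.Fin.Subset using (Subset; _∈_; _∉_; ⁅_⁆; _∩_; _∪_; ∣_∣)
open import Data.Fin.Subset.Properties using (_∈?_)
open import Data.Product.Base using (Σ; Σ-syntax; ∃-syntax; _×_; _,_; proj₁)
open import Data.Vec.Base using (tabulate)
open import Function.Base using (_∘_; _on_)
open import Function.Bundles using (Func)
open import Relation.Binary.Bundles using (Setoid)
open import Relation.Binary.Core using (Rel)
open import Relation.Binary.Definitions
  using (Symmetric; Irreflexive; Decidable; _Respects_; _Respects₂_)
open import Relation.Binary.Construct.Closure.Equivalence as Eq using (EqClosure)
open import Relation.Binary.Construct.Closure.ReflexiveTransitive using (ε; _◅_; _◅◅_)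
open import Relation.Binary.Construct.Closure.Symmetric using (fwd; bwd)
import Relation.Binary.Construct.On as On
open import Relation.Binary.PropositionalEquality
  using (_≡_; _≢_; refl)
import Relation.Binary.PropositionalEquality.Properties as ≡
open import Relation.Nullary using (¬_; yes; no; does; contradiction)
import Relation.Unary as U
open U using (Pred)

private
  variable
    ℓ : Level
    n k p : ℕ

-- Vertices form a setoid so that contraction, a quotient, can be
-- expressed. Adjacency is a relation, so there are no parallel edges.
record Graph : Set₁ where
  field
    Vertex   : Setoid 0ℓ 0ℓ
  open Setoid Vertex public using (Carrier; _≈_)
  field
    _~_      : Rel Carrier 0ℓ
    ~-sym    : Symmetric _~_
    ~-irrefl : Irreflexive _≈_ _~_
    ~-resp   : _~_ Respects₂ _≈_

record FinGraph (n : ℕ) : Set₁ where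
  field
    _~_      : Rel (Fin n) 0ℓ
    _~?_     : Decidable _~_
    ~-sym    : Symmetric _~_
    ~-irrefl : Irreflexive _≡_ _~_

⌊_⌋ : FinGraph n → Graph
⌊_⌋ {n} G = record
  { Vertex   = ≡.setoid (Fin n)
  ; _~_      = _~_
  ; ~-sym    = ~-sym
  ; ~-irrefl = ~-irrefl
  ; ~-resp   = (λ { refl e → e }) , (λ { refl e → e })
  } where open FinGraph G

Isolated : FinGraph n → Pred (Fin n) 0ℓ
Isolated G v = ∀ w → ¬ (v ~ w)
  where open FinGraph G

subset : {P : Pred (Fin n) ℓ} → U.Decidable P → Subset n
subset P? = tabulate (does ∘ P?)

N⦅_⦆ N⟦_⟧ : FinGraph n → Fin n → Subset n
N⦅ G ⦆ v = subset (v ~?_)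
  where open FinGraph G
N⟦ G ⟧ v = ⁅ v ⁆ ∪ N⦅ G ⦆ v

-- A proper coloring with at most k colors: the map into Fin k need not
-- be surjective.
record Coloring (k : ℕ) (G : Graph) : Set where
  open Graph G
  field
    color  : Func Vertex (≡.setoid (Fin k))
  open Func color public using () renaming (to to colorOf)
  field
    proper : ∀ {x y} → x ~ y → colorOf x ≢ colorOf y

Colorable : ℕ → Graph → Set
Colorable = Coloring

colorClass : (Fin n → Fin k) → Fin k → Subset n
colorClass c i = subset (λ v → c v ≟ i)

multiplicity : (G : FinGraph n) → Coloring k ⌊ G ⌋ → Fin n → Fin k → ℕ
multiplicity G c v i = ∣ N⦅ G ⦆ v ∩ colorClass (Coloring.colorOf c) i ∣

-- The membership argument is irrelevant, so such a φ is exactly a map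
-- S → [p], with no value required outside S.
preimage : (S : Subset n) → (∀ s → .(s ∈ S) → Fin p) → Fin p → Subset n
preimage {n} S φ i = subset P?
  where
  P : Pred (Fin n) 0ℓ
  P s = Σ[ s∈S ∈ s ∈ S ] φ s s∈S ≡ i

  P? : U.Decidable P
  P? s with s ∈? S
  ... | no  s∉S = no (s∉S ∘ proj₁)
  ... | yes s∈S with φ s s∈S ≟ i
  ...   | yes eq  = yes (s∈S , eq)
  ...   | no  neq = no λ { (_ , eq) → neq eq }

record ExternalSelector (Λ : Pred ℕ ℓ) (p : ℕ) (G : FinGraph n) : Set ℓ where
  open FinGraph G
  field
    S           : Subset n
    φ           : ∀ s → .(s ∈ S) → Fin p
    independent : ∀ {s t} → s ∈ S → t ∈ S → ¬ (s ~ t)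
    selects     : ∀ x → x ∉ S → ∃[ i ] Λ ∣ N⟦ G ⟧ x ∩ preimage S φ i ∣

-- The vertices of the contraction are the classes of the equivalence
-- generated by the contracted edges. Excluding equivalent endpoints
-- discards loops.
contract : FinGraph n → Rel (Fin n) 0ℓ → Graph
contract {n} G F = record
  { Vertex   = Eq.setoid F
  ; _~_      = _~′_
  ; ~-sym    = λ { (x≉y , x′ , y′ , x≈x′ , y≈y′ , e) →
                   x≉y ∘ Eq.symmetric F , y′ , x′ , y≈y′ , x≈x′ , ~-sym e }
  ; ~-irrefl = λ { x≈y (x≉y , _) → x≉y x≈y }
  ; ~-resp   =
      (λ { y≈z (x≉y , x′ , y′ , x≈x′ , y≈y′ , e) →
           (λ x≈z → x≉y (x≈z ◅◅ Eq.symmetric F y≈z))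
           , x′ , y′ , x≈x′ , Eq.symmetric F y≈z ◅◅ y≈y′ , e })
    , (λ { x≈z (x≉y , x′ , y′ , x≈x′ , y≈y′ , e) →
           (λ z≈y → x≉y (x≈z ◅◅ z≈y))
           , x′ , y′ , Eq.symmetric F x≈z ◅◅ x≈x′ , y≈y′ , e })
  }
  where
  open FinGraph G

  _~′_ : Rel (Fin n) 0ℓ
  x ~′ y = ¬ EqClosure F x y ×
    (∃[ x′ ] ∃[ y′ ] EqClosure F x x′ × EqClosure F y y′ × x′ ~ y′)

-- P has to respect _≈_ in order to be a set of vertices.
delete : (G : Graph) (P : Pred (Graph.Carrier G) 0ℓ) →
         P Respects (Graph._≈_ G) → Graph
delete G P _ = record
  { Vertex   = On.setoid {B = Σ[ x ∈ Carrier ] ¬ P x} Vertex proj₁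
  ; _~_      = _~_ on proj₁
  ; ~-sym    = ~-sym
  ; ~-irrefl = ~-irrefl
  ; ~-resp   = proj₁ ~-resp , λ x≈y → Σ.proj₂ ~-resp x≈y
  } where open Graph G

-- Irrelevance again makes the anchor depend on s alone.
record Anchors (G : FinGraph n) (S : Subset n) : Set where
  open FinGraph G
  field
    anchor   : ∀ s → .(s ∈ S) → .(¬ Isolated G s) → Fin n
    adjacent : ∀ s (s∈S : s ∈ S) (ni : ¬ Isolated G s) → s ~ anchor s s∈S ni

  AnchorEdge : Rel (Fin n) 0ℓ
  AnchorEdge s t = Σ[ s∈S ∈ s ∈ S ] Σ[ ni ∈ ¬ Isolated G s ] t ≡ anchor s s∈S ni

  Deleted : Pred (Fin n) 0ℓ
  Deleted v = v ∈ S × Isolated G v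

  Deleted-resp : Deleted Respects EqClosure AnchorEdge
  Deleted-resp ε d = d
  Deleted-resp (fwd (_ , ni , _) ◅ _) (_ , iso) = contradiction iso ni
  Deleted-resp (bwd (s∈S , ni , refl) ◅ _) (_ , iso) =
    contradiction (~-sym (adjacent _ s∈S ni)) (iso _)

  contracted : Graph
  contracted = delete (contract G AnchorEdge) Deleted Deleted-resp

{-# OPTIONS --safe #-}
-- Color s ∈ S by φ(s) and u ∉ S by the color of its class in H, shifted by p.
-- Since S is independent, every class of H is a star with exactly one vertex
-- outside S, so adjacent vertices outside S lie in adjacent classes. A vertex
-- outside S keeps the color i given by the selector. A nonisolated s ∈ S sees
-- the color of its anchor exactly once, because s lies in the class of the
-- anchor, which is therefore adjacent in H to the other neighbors of s.
module Submission where

open import Defs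
open import Data.Bool.Base using (true)
open import Data.Fin.Base using (Fin; _↑ˡ_; _↑ʳ_; splitAt)
open import Data.Fin.Properties using (splitAt-↑ˡ; splitAt-↑ʳ; ↑ˡ-injective; ↑ʳ-injective; _≟_)
open import Data.Fin.Subset using (Subset; _∈_; _∉_; ∣_∣; ⁅_⁆; _∩_)
open import Data.Fin.Subset.Properties
  using (_∈?_; x∈p∩q⁺; x∈p∩q⁻; x∈p∪q⁺; x∈p∪q⁻; x∈⁅x⁆; x∈⁅y⁆⇒x≡y; ∣⁅x⁆∣≡1; ⊆-antisym)
open import Data.Nat.Base using (ℕ; _+_; _<_)
open import Data.Product.Base using (∃-syntax; Σ-syntax; _,_; proj₁)
open import Data.Sum.Base using (_⊎_; inj₁; inj₂)
open import Data.Vec.Base using (lookup)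
open import Data.Vec.Properties using (lookup∘tabulate; lookup⇒[]=; []=⇒lookup)
open import Function.Base using (_∘_; _∋_)
open import Function.Bundles using (Func; Equivalence; _⇔_; mk⇔)
open import Relation.Binary.Construct.Closure.Equivalence using (EqClosure)
open import Relation.Binary.Construct.Closure.ReflexiveTransitive using (ε; _◅_)
open import Relation.Binary.Construct.Closure.Symmetric using (fwd; bwd)
open import Relation.Binary.PropositionalEquality
  using (_≡_; _≢_; refl; sym; trans; cong; subst)
open import Relation.Nullary using (¬_; yes; no; contradiction)
open import Relation.Nullary.Decidable using (dec-true; does)
open import Relation.Unary using (Pred; Decidable)

-- `splitAt` sends the two sides to different summands. This keeps the colors used on `S` apart from
-- those used outside it.
↑ˡ≢↑ʳ : ∀ {p q} {i : Fin p} {j : Fin q} → i ↑ˡ q ≢ p ↑ʳ j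
↑ˡ≢↑ʳ {p} {q} {i} {j} eq
  with () ← trans (sym (splitAt-↑ˡ p i q)) (trans (cong (splitAt p) eq) (splitAt-↑ʳ p q j))

module _ {n ℓ} {P : Pred (Fin n) ℓ} (P? : Decidable P) where

  ∈-subset⁺ : ∀ {x} → P x → x ∈ subset P?
  ∈-subset⁺ {x} px =
    lookup⇒[]= x _ (trans (lookup∘tabulate (does ∘ P?) x) (dec-true (P? x) px))

  ∈-subset⁻ : ∀ {x} → x ∈ subset P? → P x
  ∈-subset⁻ {x} x∈ with P? x | trans (sym (lookup∘tabulate (does ∘ P?) x)) ([]=⇒lookup x∈)
  ... | yes px | _ = px

module _ {n p} {S : Subset n} {φ : ∀ s → .(s ∈ S) → Fin p} {i : Fin p} where

  lookup-preimage : ∀ s → lookup (preimage S φ i) s ≡ true ⇔ (Σ[ s∈S ∈ s ∈ S ] φ s s∈S ≡ i)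
  lookup-preimage s
    -- The ascription recovers the decision procedure local to preimage.
    with eq ← (lookup (preimage S φ i) s ≡ _ ∋ lookup∘tabulate _ s)
    with s ∈? S
  ... | no  s∉S = mk⇔ (λ t → contradiction (trans (sym eq) t) λ ())
                      (λ { (s∈S , _) → contradiction s∈S s∉S })
  ... | yes s∈S with φ s s∈S ≟ i
  ...   | yes φ≡i = mk⇔ (λ _ → s∈S , φ≡i) (λ _ → eq)
  ...   | no  φ≢i = mk⇔ (λ t → contradiction (trans (sym eq) t) λ ())
                        (λ { (_ , φ≡i) → contradiction φ≡i φ≢i })

  ∈-preimage⁺ : ∀ {s} (s∈S : s ∈ S) → φ s s∈S ≡ i → s ∈ preimage S φ i
  ∈-preimage⁺ s∈S eq = lookup⇒[]= _ _ (Equivalence.from (lookup-preimage _) (s∈S , eq))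

  ∈-preimage⁻ : ∀ {s} → s ∈ preimage S φ i → Σ[ s∈S ∈ s ∈ S ] φ s s∈S ≡ i
  ∈-preimage⁻ = Equivalence.to (lookup-preimage _) ∘ []=⇒lookup

module _ {n ℓ} {Λ : Pred ℕ ℓ} {p} {G : FinGraph n}
         (σ : ExternalSelector Λ p G)
         (a : Anchors G (ExternalSelector.S σ)) where
  open FinGraph G
  open ExternalSelector σ
  open Anchors a

  anchor∉S : ∀ {s} (s∈S : s ∈ S) (ni : ¬ Isolated G s) → anchor s s∈S ni ∉ S
  anchor∉S s∈S ni t∈S = independent s∈S t∈S (adjacent _ s∈S ni)

  -- Each contracted class meeting V(G) ∖ S is a star centred at its
  -- unique vertex outside S.
  InStar : Fin n → Fin n → Set
  InStar u x = x ≡ u ⊎ AnchorEdge x u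

  -- Induction on the path. The centre `u` is outside `S`, so a step from it leads back along an
  -- anchor edge to a leaf. A leaf is in `S`, hence no anchor, so a step from it leads to its own
  -- anchor, which is `u`.
  InStar-closed : ∀ {u x y} → u ∉ S → InStar u x → EqClosure AnchorEdge x y → InStar u y
  InStar-closed u∉S x∈u ε = x∈u
  InStar-closed u∉S (inj₁ refl) (fwd (u∈S , _) ◅ _) = contradiction u∈S u∉S
  InStar-closed u∉S (inj₁ refl) (bwd e ◅ es) = InStar-closed u∉S (inj₂ e) es
  InStar-closed u∉S (inj₂ (_ , _ , refl)) (fwd (_ , _ , refl) ◅ es) =
    InStar-closed u∉S (inj₁ refl) es
  InStar-closed u∉S (inj₂ (x∈S , _)) (bwd (y∈S , ni , refl) ◅ _) =
    contradiction x∈S (anchor∉S y∈S ni)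

  equivalent⇒≡ : ∀ {u w} → u ∉ S → w ∉ S → EqClosure AnchorEdge u w → w ≡ u
  equivalent⇒≡ u∉S w∉S u≈w with InStar-closed u∉S (inj₁ refl) u≈w
  ... | inj₁ eq        = eq
  ... | inj₂ (w∈S , _) = contradiction w∈S w∉S

  module _ {q} (h : Colorable q contracted) where
    open Coloring h using () renaming (color to hFunc; colorOf to hColor; proper to hProper)

    outerColor : ∀ u → u ∉ S → Fin q
    outerColor u u∉S = hColor (u , u∉S ∘ proj₁)

    -- The classes of `u` and `w` differ, so the edge `x ~ w` survives contraction instead of
    -- becoming a loop. Properness takes `x` to be `u`; the count at a vertex of `S` takes `x` to be
    -- a leaf anchored at `u`.
    outerColor-≢ : ∀ {u x w} (u∉S : u ∉ S) (w∉S : w ∉ S) → w ≢ u →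
                   EqClosure AnchorEdge u x → x ~ w → outerColor u u∉S ≢ outerColor w w∉S
    outerColor-≢ u∉S w∉S w≢u u≈x x~w =
      hProper (w≢u ∘ equivalent⇒≡ u∉S w∉S , _ , _ , u≈x , ε , x~w)

    liftColor : Fin n → Fin (p + q)
    liftColor v with v ∈? S
    ... | yes v∈S = φ v v∈S ↑ˡ q
    ... | no  v∉S = p ↑ʳ outerColor v v∉S

    liftColor-∈ : ∀ {s} (s∈S : s ∈ S) → liftColor s ≡ φ s s∈S ↑ˡ q
    liftColor-∈ {s} s∈S with s ∈? S
    ... | yes _   = refl
    ... | no  s∉S = contradiction s∈S s∉S

    liftColor-∉ : ∀ {u} (u∉S : u ∉ S) → liftColor u ≡ p ↑ʳ outerColor u u∉S
    liftColor-∉ {u} u∉S with u ∈? S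
    ... | yes u∈S = contradiction u∈S u∉S
    -- The empty path identifies the vertices of `contracted` built from the two proofs that `u` is
    -- outside `S`, and `hFunc` respects this.
    ... | no  _   = cong (p ↑ʳ_) (Func.cong hFunc ε)

    liftColor-proper : ∀ {x y} → x ~ y → liftColor x ≢ liftColor y
    liftColor-proper {x} {y} x~y with x ∈? S | y ∈? S
    ... | yes x∈S | yes y∈S = contradiction x~y (independent x∈S y∈S)
    ... | yes _   | no  _   = ↑ˡ≢↑ʳ
    ... | no  _   | yes _   = ↑ˡ≢↑ʳ ∘ sym
    ... | no  x∉S | no  y∉S =
      outerColor-≢ x∉S y∉S (λ y≡x → ~-irrefl (sym y≡x) x~y) ε x~y ∘ ↑ʳ-injective p _ _

    liftColoring : Coloring (p + q) ⌊ G ⌋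
    liftColoring = record
      { color  = record { to = liftColor ; cong = cong liftColor }
      ; proper = liftColor-proper
      }

    -- The two sets coincide: closing the neighborhood adds only `u`, which is not in `S`, and a
    -- color of the form `i ↑ˡ q` occurs only on `S`.
    multiplicity-∉ : ∀ {u} → u ∉ S → ∀ i →
      ∣ N⟦ G ⟧ u ∩ preimage S φ i ∣ ≡ multiplicity G liftColoring u (i ↑ˡ q)
    multiplicity-∉ {u} u∉S i = cong ∣_∣ (⊆-antisym to from)
      where
      to : ∀ {x} → x ∈ N⟦ G ⟧ u ∩ preimage S φ i →
           x ∈ N⦅ G ⦆ u ∩ colorClass liftColor (i ↑ˡ q)
      to x∈ with x∈N , x∈φ⁻¹ ← x∈p∩q⁻ _ _ x∈ with x∈S , refl ← ∈-preimage⁻ {φ = φ} x∈φ⁻¹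
        with x∈p∪q⁻ _ _ x∈N
      ... | inj₁ x∈⁅u⁆ = contradiction (subst (_∈ S) (x∈⁅y⁆⇒x≡y _ x∈⁅u⁆) x∈S) u∉S
      ... | inj₂ x∈Nu  = x∈p∩q⁺ (x∈Nu , ∈-subset⁺ (λ v → liftColor v ≟ _) (liftColor-∈ x∈S))

      from : ∀ {x} → x ∈ N⦅ G ⦆ u ∩ colorClass liftColor (i ↑ˡ q) →
             x ∈ N⟦ G ⟧ u ∩ preimage S φ i
      from {x} x∈ with x∈N , x∈c ← x∈p∩q⁻ _ _ x∈
        with eq ← ∈-subset⁻ (λ v → liftColor v ≟ _) x∈c with x ∈? S
      ... | yes x∈S = x∈p∩q⁺ (x∈p∪q⁺ (inj₂ x∈N) , ∈-preimage⁺ {φ = φ} x∈S (↑ˡ-injective q _ _ eq))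
      ... | no  _   = contradiction (sym eq) ↑ˡ≢↑ʳ

    -- By independence all neighbors of `s` lie outside `S`, so their colors come from `h`, which
    -- separates the anchor from each of the others.
    multiplicity-anchor : ∀ {s} (s∈S : s ∈ S) (ni : ¬ Isolated G s) →
      multiplicity G liftColoring s (liftColor (anchor s s∈S ni)) ≡ 1
    multiplicity-anchor {s} s∈S ni = trans (cong ∣_∣ (⊆-antisym to from)) (∣⁅x⁆∣≡1 t)
      where
      t : Fin n
      t = anchor s s∈S ni

      t∉S : t ∉ S
      t∉S = anchor∉S s∈S ni

      to : ∀ {x} → x ∈ N⦅ G ⦆ s ∩ colorClass liftColor (liftColor t) → x ∈ ⁅ t ⁆
      to {x} x∈ with x∈N , x∈c ← x∈p∩q⁻ _ _ x∈
        with s~x ← ∈-subset⁻ (s ~?_) x∈N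
           | eq ← ∈-subset⁻ (λ v → liftColor v ≟ _) x∈c
        with x ≟ t
      ... | yes refl = x∈⁅x⁆ t
      ... | no x≢t   = contradiction
        (↑ʳ-injective p _ _ (trans (sym (liftColor-∉ t∉S)) (trans (sym eq) (liftColor-∉ x∉S))))
        -- One backward step along the anchor edge puts `s` in the class of `t`, so `s ~ x` joins
        -- the classes of `t` and `x`.
        (outerColor-≢ t∉S x∉S x≢t (bwd (s∈S , ni , refl) ◅ ε) s~x)
        where
        x∉S : x ∉ S
        x∉S x∈S = independent s∈S x∈S s~x

      from : ∀ {x} → x ∈ ⁅ t ⁆ → x ∈ N⦅ G ⦆ s ∩ colorClass liftColor (liftColor t)
      from x∈ with refl ← x∈⁅y⁆⇒x≡y _ x∈ =
        x∈p∩q⁺ ( ∈-subset⁺ (s ~?_) (adjacent s s∈S ni)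
               , ∈-subset⁺ (λ v → liftColor v ≟ _) refl )

lemma3p1 : ∀ {ℓ} (Λ : Pred ℕ ℓ) → (∀ {m} → Λ m → 0 < m) → Λ 1 →
    (p q : ℕ) {n : ℕ} (G : FinGraph n) →
    (σ : ExternalSelector Λ p G) →
    (a : Anchors G (ExternalSelector.S σ)) →
    Colorable q (Anchors.contracted a) →
    Σ[ c ∈ Coloring (p + q) ⌊ G ⌋ ]
    (∀ v → ¬ Isolated G v → ∃[ i ] Λ (multiplicity G c v i))
lemma3p1 Λ _ 1∈Λ p q G σ a h = liftColoring σ a h , good
  where
  open ExternalSelector σ using (S; selects)

  good : ∀ v → ¬ Isolated G v → ∃[ i ] Λ (multiplicity G (liftColoring σ a h) v i)
  good v ni with v ∈? S
  -- The implicit witness is the color of the anchor of `v`.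
  ... | yes v∈S = _ , subst Λ (sym (multiplicity-anchor σ a h v∈S ni)) 1∈Λ
  ... | no  v∉S with i , m∈Λ ← selects v v∉S =
    i ↑ˡ q , subst Λ (multiplicity-∉ σ a h v∉S i) m∈Λ
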